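{- Let $G$ be a finite group and let $Max_G=\{x_1,\dots,x_m\}$ be an essential cyclic set of $G$ with $icn(G)=0$. Then: $rc(\Gamma_G^e)=1$ if and only if $G$ is cyclic; $rc(\Gamma_G^e)=2$ if and only if $G$ has an awning and $G$ is not cyclic; $rc(\Gamma_G^e)=3$ if and only if $G$ does not have an awning.
   Context: Let $G$ be a finite group with identity $e$. The enhanced power graph $\Gamma_G^e$ has vertex set $G$, two distinct vertices $x,y$ being adjacent iff $x,y\in\langle z\rangle$ for some $z\in G$. For a connected graph $\Gamma$, an edge-colouring $\zeta:E(\Gamma)\to\{1,\dots,k\}$ (not necessarily proper) is a rainbow $k$-colouring if every pair of distinct vertices is joined by a path whose edges have pairwise distinct colours; $rc(\Gamma)$ is the minimum such $k$. An essential cyclic set $Max_G=\{x_1,\dots,x_m\}$ is a set of elements of $G$ such that $\langle x_1\rangle,\dots,\langle x_m\rangle$ are pairwise distinct and are exactly the maximal cyclic subgroups of $G$. The independence cyclic set is $ics(G)=\{x_i\in Max_G:\langle x_i\rangle\cap\langle x_j\rangle=\{e\}\text{ for all }j\neq i\}$ and $icn(G)=|ics(G)|$. Awning: given an ordering $x_1,\dots,x_m$ of $Max_G$, an awning is a family of indexed sets $H_1,\dots,H_{m-1}$, where $H_i=\{h_{i,i+1},\dots,h_{i,m}\}\subseteq\langle x_i\rangle$ is partitioned as $H_i=A_i\,\dot\cup\,B_i$, such that (1) $h_{i,j}\in\langle x_i\rangle\cap\langle x_j\rangle$ for all $i<j$; (2) whenever $i<j$, $2\le j\le m-1$, $s\in\{j+1,\dots,m\}$,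 $r\in\{i+1,\dots,m\}$ and $h_{j,s}=h_{i,r}$: (a) if $r=j$ and $h_{i,r}\in A_i$ then $h_{j,s}\in B_j$; (b) if $r=j$ and $h_{i,r}\in B_i$ then $h_{j,s}\in A_j$; (c) if $r=s>j$ and $h_{i,r}\in A_i$ then $h_{j,r}\in A_j$; (d) if $r=s>j$ and $h_{i,r}\in B_i$ then $h_{j,r}\in B_j$. $G$ has an awning if an awning exists for some ordering of $Max_G$. -}

module Defs where

open import Data.Nat using (ℕ; zero; suc; _<_)
open import Data.Fin using (Fin) renaming (_<_ to _<ᶠ_)
open import Data.Fin.Permutation using (Permutation′; _⟨$⟩ʳ_)
open import Data.Bool using (Bool; true; false)
open import Data.List using (List; []; _∷_)
open import Data.List.Relation.Unary.Unique.Propositional using (Unique)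
open import Data.Product using (Σ; ∃; _×_; _,_)
open import Relation.Nullary using (¬_)
open import Relation.Binary.PropositionalEquality using (_≡_; _≢_)
open import Algebra.Structures using (IsGroup)
open import Function.Bundles using (_⇔_)

record FiniteGroup : Set where
  field
    order   : ℕ
    _∙_     : Fin order → Fin order → Fin order
    ε       : Fin order
    _⁻¹     : Fin order → Fin order
    isGroup : IsGroup _≡_ _∙_ ε _⁻¹

module _ (G : FiniteGroup) where
  open FiniteGroup G

  Elt : Set
  Elt = Fin order

  pow : Elt → ℕ → Elt
  pow g zero    = ε
  pow g (suc k) = g ∙ pow g k

  -- y ∈ ⟨ g ⟩  (G finite, so natural powers give the whole cyclic subgroup)
  InCyc : Elt → Elt → Set
  InCyc y g = ∃ λ k → pow g k ≡ y

  CycSub : Elt → Elt → Set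
  CycSub g h = ∀ y → InCyc y g → InCyc y h

  SameCyc : Elt → Elt → Set
  SameCyc g h = CycSub g h × CycSub h g

  IsCyclic : Set
  IsCyclic = ∃ λ g → ∀ y → InCyc y g

  MaxCyclic : Elt → Set
  MaxCyclic g = ∀ h → CycSub g h → CycSub h g

  record IsEssentialCyclicSet (m : ℕ) (x : Fin m → Elt) : Set where
    field
      distinct : ∀ i j → i ≢ j → ¬ SameCyc (x i) (x j)
      maximal  : ∀ i → MaxCyclic (x i)
      complete : ∀ g → MaxCyclic g → ∃ λ i → SameCyc g (x i)

  InIcs : (m : ℕ) → (Fin m → Elt) → Fin m → Set
  InIcs m x i = ∀ j → j ≢ i → ∀ y → InCyc y (x i) → InCyc y (x j) → y ≡ ε

  IcnZero : (m : ℕ) → (Fin m → Elt) → Set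
  IcnZero m x = ∀ i → ¬ InIcs m x i

  -- Awning for the ordered sequence y_0,…,y_{m-1} (0-based indices).
  -- h i j = h_{i,j} (only used for i < j); inA i g = true iff g ∈ A_i
  -- (g ∈ B_i otherwise), so H_i = A_i ⊎ B_i as sets.
  record IsAwning (m : ℕ) (y : Fin m → Elt)
                  (h : Fin m → Fin m → Elt) (inA : Fin m → Elt → Bool) : Set where
    field
      cond1  : ∀ i j → i <ᶠ j → InCyc (h i j) (y i) × InCyc (h i j) (y j)
      cond2a : ∀ i j s r → i <ᶠ j → j <ᶠ s → i <ᶠ r → h j s ≡ h i r →
               r ≡ j → inA i (h i r) ≡ true → inA j (h j s) ≡ false
      cond2b : ∀ i j s r → i <ᶠ j → j <ᶠ s → i <ᶠ r → h j s ≡ h i r →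
               r ≡ j → inA i (h i r) ≡ false → inA j (h j s) ≡ true
      cond2c : ∀ i j s r → i <ᶠ j → j <ᶠ s → i <ᶠ r → h j s ≡ h i r →
               r ≡ s → inA i (h i r) ≡ true → inA j (h j r) ≡ true
      cond2d : ∀ i j s r → i <ᶠ j → j <ᶠ s → i <ᶠ r → h j s ≡ h i r →
               r ≡ s → inA i (h i r) ≡ false → inA j (h j r) ≡ false

  HasAwning : (m : ℕ) → (Fin m → Elt) → Set
  HasAwning m x = Σ (Permutation′ m) λ σ →
                  ∃ λ h → ∃ λ inA → IsAwning m (λ i → x (σ ⟨$⟩ʳ i)) h inA

  Adj : Elt → Elt → Set
  Adj a b = a ≢ b × ∃ λ z → InCyc a z × InCyc b z

  record EdgeColouring (k : ℕ) : Set where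
    field
      col : Elt → Elt → Fin k
      sym : ∀ a b → Adj a b → col a b ≡ col b a

  data RPath {k : ℕ} (ζ : EdgeColouring k) : Elt → Elt → List (Fin k) → List Elt → Set where
    here : ∀ a → RPath ζ a a [] (a ∷ [])
    step : ∀ {a b c cs vs} → Adj a b → RPath ζ b c cs vs →
           RPath ζ a c (EdgeColouring.col ζ a b ∷ cs) (a ∷ vs)

  IsRainbowColouring : {k : ℕ} → EdgeColouring k → Set
  IsRainbowColouring ζ = ∀ a b → a ≢ b →
    ∃ λ cs → ∃ λ vs → RPath ζ a b cs vs × Unique vs × Unique cs

  HasRainbowColouring : ℕ → Set
  HasRainbowColouring k = Σ (EdgeColouring k) IsRainbowColouring

  RcEq : ℕ → Set
  RcEq k = HasRainbowColouring k × (∀ j → j < k → ¬ HasRainbowColouring j)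

{-# OPTIONS --safe #-}
module Submission where

-- Vanishing icn makes G non-cyclic and gives every v ≢ e a neighbour other than e. Splitting
-- G ∖ {e} by a maximal independent set, colouring the spokes to e by side and all
-- other edges with a third colour, is then rainbow, so rc ≤ 3.
--
-- An awning amounts to two-valued C i on ⟨y i⟩ and elements h i j of ⟨y i⟩ ∩ ⟨y j⟩ with
-- C i (h i j) ≢ C j (h i j); a rainbow 2-colouring gives one by restriction to the edges at
-- the generators. Conversely, let ι a be the least i with a ∈ ⟨y i⟩, and rename the
-- values of C at each g so that C (ι g) g is zero. Colour an edge a – g by C (ι a) g when
-- g ∈ ⟨y (ι a)⟩, and by C (ι g) a when a ∈ ⟨y (ι g)⟩. If both apply, minimality forces ι a ≡ ι g,
-- so both colours are zero. Hence a – h (ι a) (ι b) – b is rainbow.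

open import Defs
open import Data.Nat using (ℕ; zero; suc; _+_; _*_; _%_; _/_; s≤s; z≤n)
import Data.Nat as ℕ
import Data.Nat.Properties as ℕₚ
open import Data.Nat.DivMod using (m≡m%n+[m/n]*n; m%n<n)
open import Data.Fin using (Fin; zero; suc; toℕ; fromℕ<; _<_; _≤_)
open import Data.Fin.Properties
  using (_≟_; _<?_; any?; pigeonhole; toℕ-fromℕ<; ≤-antisym; <-cmp; <⇒≢)
open import Data.Fin.Induction using (spo-noetherian)
open import Data.Fin.Permutation using (Permutation′; _⟨$⟩ʳ_; _⟨$⟩ˡ_; inverseʳ)
import Data.Fin.Permutation as Perm
open import Data.Bool using (Bool; true; false; not; if_then_else_)
import Data.Bool.Properties as 𝔹
open import Data.List using (List; []; _∷_; allFin)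
open import Data.List.Relation.Unary.All using ([]; _∷_)
open import Data.List.Relation.Unary.Any as Any using (here; there)
open import Data.List.Relation.Unary.AllPairs using ([]; _∷_)
open import Data.List.Relation.Unary.Unique.Propositional using (Unique)
open import Data.List.Membership.Propositional using (_∈_; find; lose)
open import Data.List.Membership.Propositional.Properties using (∈-allFin)
import Data.List.Membership.DecPropositional as DecMembership
open import Data.Product using (∃; _×_; _,_; proj₁; proj₂)
open import Data.Sum using (_⊎_; inj₁; inj₂)
open import Data.Empty using (⊥; ⊥-elim)
open import Relation.Nullary using (¬_; Dec; yes; no; does; contradiction)
open import Relation.Nullary.Decidable using (map′; _×-dec_; ¬?)
open import Relation.Unary using (Pred)
import Relation.Unary as U
open import Relation.Binary using (Rel; Decidable; Symmetric; Irreflexive; tri<; tri≈; tri>)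
open import Relation.Binary.Structures using (IsStrictPartialOrder)
open import Relation.Binary.PropositionalEquality
  using (_≡_; _≢_; refl; sym; trans; cong; subst; isEquivalence; resp₂; module ≡-Reasoning)
open import Algebra.Bundles using (Group)
import Algebra.Properties.Group as GroupProperties
open import Function.Base using (_∘_; flip)
open import Function.Bundles using (_⇔_; mk⇔; Equivalence)
open import Induction.WellFounded using (Acc; acc)
open import Level using (0ℓ)

-- Selection and counting on finite index sets.

least : ∀ {n} {P : Pred (Fin n) 0ℓ} → U.Decidable P → ∃ P →
        ∃ λ i → P i × (∀ j → P j → i ≤ j)
least {suc n} P? w with P? zero
least {suc n} P? w | yes p₀ = zero , p₀ , λ _ _ → z≤n
least {suc n} P? (zero , p) | no ¬p₀ = contradiction p ¬p₀
least {suc n} P? (suc i , p) | no ¬p₀ =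
  let k , pₖ , min = least (P? ∘ suc) (i , p) in
  suc k , pₖ , λ { zero p₀ → contradiction p₀ ¬p₀ ; (suc j) pⱼ → s≤s (min j pⱼ) }

-- Caps rainbow paths in two colours at two edges.
fin2-pigeonhole : (c d e : Fin 2) → c ≢ d → c ≢ e → d ≢ e → ⊥
fin2-pigeonhole zero       zero       _          c≢d _ _ = c≢d refl
fin2-pigeonhole (suc zero) (suc zero) _          c≢d _ _ = c≢d refl
fin2-pigeonhole zero       (suc zero) zero       _ c≢e _ = c≢e refl
fin2-pigeonhole zero       (suc zero) (suc zero) _ _ d≢e = d≢e refl
fin2-pigeonhole (suc zero) zero       zero       _ _ d≢e = d≢e refl
fin2-pigeonhole (suc zero) zero       (suc zero) _ c≢e _ = c≢e refl

-- Maximal independent sets in a finite graph.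

module _ {n} {R : Rel (Fin n) 0ℓ} (R? : Decidable R)
         (R-sym : Symmetric R) (R-irrefl : Irreflexive _≡_ R) where

  open DecMembership (_≟_ {n}) using (_∈?_)

  Independent : List (Fin n) → Set
  Independent S = ∀ {u v} → u ∈ S → v ∈ S → ¬ R u v

  Dominates : List (Fin n) → Fin n → Set
  Dominates S v = v ∈ S ⊎ ∃ λ w → w ∈ S × R v w

  -- Greedy choice: a vertex joins `S` only if it has no neighbour there yet. Independence persists,
  -- and a rejected vertex is dominated by the neighbour that barred it.
  independentDominating : ∀ vs → ∃ λ S → Independent S × (∀ {v} → v ∈ vs → Dominates S v)
  independentDominating [] = [] , (λ ()) , λ ()
  independentDominating (v ∷ vs) with independentDominating vs
  ... | S , ind , dom with Any.any? (R? v) S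
  ...   | yes nb = S , ind , λ { (here refl) → inj₂ (find nb) ; (there u∈) → dom u∈ }
  ...   | no ¬nb = v ∷ S , ind′ , dom′
    where
    ind′ : Independent (v ∷ S)
    ind′ (here refl) (here refl) r = R-irrefl refl r
    ind′ (here refl) (there w∈)  r = ¬nb (lose w∈ r)
    ind′ (there u∈)  (here refl) r = ¬nb (lose u∈ (R-sym r))
    ind′ (there u∈)  (there w∈)  r = ind u∈ w∈ r
    dom′ : ∀ {u} → u ∈ v ∷ vs → Dominates (v ∷ S) u
    dom′ (here refl) = inj₁ (here refl)
    dom′ (there u∈) with dom u∈
    ... | inj₁ u∈S           = inj₁ (there u∈S)
    ... | inj₂ (w , w∈S , r) = inj₂ (w , there w∈S , r)

  -- One side is a maximal independent set: every neighbour of a member lies outside by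
  -- independence, and a non-member has a neighbour inside by domination.
  unfriendlyPartition : ∃ λ (side : Fin n → Bool) →
                        ∀ v → ∃ (R v) → ∃ λ w → R v w × side v ≢ side w
  unfriendlyPartition = side , cross
    where
    S   = proj₁ (independentDominating (allFin n))
    ind = proj₁ (proj₂ (independentDominating (allFin n)))
    dom = proj₂ (proj₂ (independentDominating (allFin n)))
    side : Fin n → Bool
    side v = does (v ∈? S)
    cross : ∀ v → ∃ (R v) → ∃ λ w → R v w × side v ≢ side w
    cross v (w , r) with v ∈? S | dom (∈-allFin v)
    cross v (w , r) | yes v∈ | _ = w , r , differ
      where
      differ : true ≢ does (w ∈? S)
      differ with w ∈? S
      ... | yes w∈ = λ _ → ind v∈ w∈ r
      ... | no _   = λ ()
    cross v _ | no v∉ | inj₁ v∈ = contradiction v∈ v∉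
    cross v _ | no v∉ | inj₂ (w , w∈ , r) = w , r , differ
      where
      differ : false ≢ does (w ∈? S)
      differ with w ∈? S
      ... | yes _  = λ ()
      ... | no w∉  = λ _ → w∉ w∈

-- Powers and cyclic subgroups.

module _ (G : FiniteGroup) where
  open FiniteGroup G

  private
    group : Group 0ℓ 0ℓ
    group = record { isGroup = isGroup }

  open Group group using (assoc; identityˡ; identityʳ)
  open GroupProperties group using (∙-cancelˡ)

  pow-+ : ∀ g k l → pow G g (k + l) ≡ pow G g k ∙ pow G g l
  pow-+ g zero    l = sym (identityˡ _)
  pow-+ g (suc k) l = trans (cong (g ∙_) (pow-+ g k l)) (sym (assoc _ _ _))

  pow-* : ∀ g k l → pow G g (k * l) ≡ pow G (pow G g l) k
  pow-* g zero    l = refl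
  pow-* g (suc k) l = trans (pow-+ g l (k * l)) (cong (pow G g l ∙_) (pow-* g k l))

  pow-ε : ∀ k → pow G ε k ≡ ε
  pow-ε zero    = refl
  pow-ε (suc k) = trans (identityˡ _) (pow-ε k)

  -- Among the powers with exponents 0 to `order` two coincide; cancelling the one with the smaller
  -- exponent leaves a positive exponent, hence the `suc`.
  pow-period : ∀ g → ∃ λ d → pow G g (suc d) ≡ ε
  pow-period g with pigeonhole (ℕₚ.n<1+n order) (pow G g ∘ toℕ)
  ... | i , j , i<j , eq with ℕₚ.m≤n⇒∃[o]m+o≡n i<j
  ...   | d , 1+i+d≡j = d , ∙-cancelˡ (pow G g (toℕ i)) _ _ (begin
    pow G g (toℕ i) ∙ pow G g (suc d)  ≡⟨ pow-+ g (toℕ i) (suc d) ⟨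
    pow G g (toℕ i + suc d)            ≡⟨ cong (pow G g) (trans (ℕₚ.+-suc (toℕ i) d) 1+i+d≡j) ⟩
    pow G g (toℕ j)                    ≡⟨ eq ⟨
    pow G g (toℕ i)                    ≡⟨ identityʳ _ ⟨
    pow G g (toℕ i) ∙ ε                ∎)
    where open ≡-Reasoning

  -- Abstract, since with-abstractions would otherwise unfold the pigeonhole search.
  abstract
    inCyc? : ∀ y g → Dec (InCyc G y g)
    inCyc? y g with pow-period g
    ... | d , gᵈ⁺¹≡ε = map′ (λ (i , eq) → toℕ i , eq) bounded (any? λ i → pow G g (toℕ i) ≟ y)
      where
      open ≡-Reasoning
      -- Exponents matter only modulo the period `suc d`, so a search through the first `suc d`
      -- powers suffices.
      reduce : ∀ k → pow G g (k % suc d) ≡ pow G g k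
      reduce k = sym (begin
        pow G g k                                                  ≡⟨ cong (pow G g) (m≡m%n+[m/n]*n k (suc d)) ⟩
        pow G g (k % suc d + k / suc d * suc d)                    ≡⟨ pow-+ g (k % suc d) _ ⟩
        pow G g (k % suc d) ∙ pow G g (k / suc d * suc d)          ≡⟨ cong (pow G g (k % suc d) ∙_) (pow-* g (k / suc d) (suc d)) ⟩
        pow G g (k % suc d) ∙ pow G (pow G g (suc d)) (k / suc d)  ≡⟨ cong (λ t → pow G g (k % suc d) ∙ pow G t (k / suc d)) gᵈ⁺¹≡ε ⟩
        pow G g (k % suc d) ∙ pow G ε (k / suc d)                  ≡⟨ cong (pow G g (k % suc d) ∙_) (pow-ε (k / suc d)) ⟩
        pow G g (k % suc d) ∙ ε                                    ≡⟨ identityʳ _ ⟩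
        pow G g (k % suc d)                                        ∎)
      bounded : InCyc G y g → ∃ λ (i : Fin (suc d)) → pow G g (toℕ i) ≡ y
      bounded (k , eq) = fromℕ< (m%n<n k (suc d)) ,
        trans (cong (pow G g) (toℕ-fromℕ< (m%n<n k (suc d)))) (trans (reduce k) eq)

  inCyc-refl : ∀ {g} → InCyc G g g
  inCyc-refl = 1 , identityʳ _

  inCyc-trans : ∀ {a b c} → InCyc G a b → InCyc G b c → InCyc G a c
  inCyc-trans {c = c} (k , refl) (l , refl) = k * l , pow-* c k l

  inCyc-ε : ∀ {g} → InCyc G ε g
  inCyc-ε = 0 , refl

  inCyc⇒cycSub : ∀ {g h} → InCyc G g h → CycSub G g h
  inCyc⇒cycSub g∈h y y∈g = inCyc-trans y∈g g∈h

  maxCyclic-absorbs : ∀ {g z} → MaxCyclic G g → InCyc G g z → InCyc G z g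
  maxCyclic-absorbs {z = z} max g∈z = max z (inCyc⇒cycSub g∈z) z inCyc-refl

  ProperSub : Rel (Elt G) 0ℓ
  ProperSub g h = InCyc G g h × ¬ InCyc G h g

  properSub-isSPO : IsStrictPartialOrder _≡_ ProperSub
  properSub-isSPO = record
    { isEquivalence = isEquivalence
    ; irrefl        = λ { refl (p , ¬p) → ¬p p }
    ; trans         = λ (p , ¬p) (q , ¬q) → inCyc-trans p q , λ r → ¬q (inCyc-trans r p)
    ; <-resp-≈      = resp₂ ProperSub
    }

  -- Climb through strictly larger cyclic subgroups. Strict inclusion, read on generators, is a
  -- strict partial order on a finite set, so the climb ends.
  inMaxCyclic : ∀ a → ∃ λ z → MaxCyclic G z × InCyc G a z
  inMaxCyclic a = climb a (spo-noetherian properSub-isSPO a)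
    where
    climb : ∀ g → Acc (flip ProperSub) g → ∃ λ z → MaxCyclic G z × InCyc G g z
    climb g (acc above) with any? (λ h → inCyc? g h ×-dec ¬? (inCyc? h g))
    ... | yes (h , g⊏h) =
      let z , max , h∈z = climb h (above g⊏h) in z , max , inCyc-trans (proj₁ g⊏h) h∈z
    ... | no maximal = g , isMax , inCyc-refl
      where
      isMax : MaxCyclic G g
      isMax h g⊆h with inCyc? h g
      ... | yes h∈g = inCyc⇒cycSub h∈g
      ... | no h∉g  = contradiction (h , g⊆h g inCyc-refl , h∉g) maximal

  -- Adjacency and short rainbow paths.

  adj-sym : Symmetric (Adj G)
  adj-sym (a≢b , z , a∈z , b∈z) = a≢b ∘ sym , z , b∈z , a∈z

  adj? : Decidable (Adj G)
  adj? a b = ¬? (a ≟ b) ×-dec any? (λ z → inCyc? a z ×-dec inCyc? b z)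

  adj-ε : ∀ {a} → a ≢ ε → Adj G a ε
  adj-ε {a} a≢ε = a≢ε , a , inCyc-refl , inCyc-ε

  -- The cyclic subgroup witnessing the edge contains ⟨g⟩, so it equals ⟨g⟩ by maximality. This
  -- places the middle vertex of a two-edge path between generators in both of their subgroups.
  maxCyclic-adj : ∀ {g a} → MaxCyclic G g → Adj G g a → InCyc G a g
  maxCyclic-adj max (_ , z , g∈z , a∈z) = inCyc-trans a∈z (maxCyclic-absorbs max g∈z)

  RainbowConnected : ∀ {k} → EdgeColouring G k → Elt G → Elt G → Set
  RainbowConnected ζ a b = ∃ λ cs → ∃ λ vs → RPath G ζ a b cs vs × Unique vs × Unique cs

  module _ {k} (ζ : EdgeColouring G k) where
    open EdgeColouring ζ using (col)

    rainbow₁ : ∀ {a b} → Adj G a b → RainbowConnected ζ a b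
    rainbow₁ {a} {b} ab =
      _ , _ , step ab (here b) , (proj₁ ab ∷ []) ∷ [] ∷ [] , [] ∷ []

    rainbow₂ : ∀ {a b c} → Adj G a b → Adj G b c → a ≢ c → col a b ≢ col b c →
               RainbowConnected ζ a c
    rainbow₂ {c = c} ab bc a≢c ab≢bc = _ , _ , step ab (step bc (here c)) ,
      (proj₁ ab ∷ a≢c ∷ []) ∷ (proj₁ bc ∷ []) ∷ [] ∷ [] , (ab≢bc ∷ []) ∷ [] ∷ []

    rainbow₃ : ∀ {a b c d} → Adj G a b → Adj G b c → Adj G c d →
               a ≢ c → a ≢ d → b ≢ d →
               col a b ≢ col b c → col a b ≢ col c d → col b c ≢ col c d →
               RainbowConnected ζ a d
    rainbow₃ {d = d} ab bc cd a≢c a≢d b≢d ab≢bc ab≢cd bc≢cd =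
      _ , _ , step ab (step bc (step cd (here d))) ,
      (proj₁ ab ∷ a≢c ∷ a≢d ∷ []) ∷ (proj₁ bc ∷ b≢d ∷ []) ∷ (proj₁ cd ∷ []) ∷ [] ∷ [] ,
      (ab≢bc ∷ ab≢cd ∷ []) ∷ (bc≢cd ∷ []) ∷ [] ∷ []

  nonadjacent⇒¬rainbow-1 : ∀ {a b} → a ≢ b → ¬ Adj G a b → ¬ HasRainbowColouring G 1
  nonadjacent⇒¬rainbow-1 {a} {b} a≢b ¬ab (ζ , rainbow) with rainbow a b a≢b
  ... | _ , _ , here _ , _ = a≢b refl
  ... | _ , _ , step ab (here _) , _ = ¬ab ab
  ... | _ , _ , step {a = u} {b = v} _ (step {b = w} _ _) , _ , (≢ ∷ _) ∷ _
    with EdgeColouring.col ζ u v | EdgeColouring.col ζ v w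
  ...   | zero | zero = ≢ refl

  -- Two colours allow at most two edges on a rainbow path, and nonadjacency excludes fewer than
  -- two.
  nonadjacent⇒via : ∀ {a b} ((ζ , _) : HasRainbowColouring G 2) → a ≢ b → ¬ Adj G a b →
    ∃ λ g → Adj G a g × Adj G g b × EdgeColouring.col ζ a g ≢ EdgeColouring.col ζ g b
  nonadjacent⇒via {a} {b} (ζ , rainbow) a≢b ¬ab with rainbow a b a≢b
  ... | _ , _ , here _ , _ = contradiction refl a≢b
  ... | _ , _ , step ab (here _) , _ = contradiction ab ¬ab
  ... | _ , _ , step ag (step gb (here _)) , _ , (≢ ∷ _) ∷ _ = _ , ag , gb , ≢
  ... | _ , _ , step _ (step _ (step _ _)) , _ , (c≢d ∷ c≢e ∷ _) ∷ (d≢e ∷ _) ∷ _ =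
    ⊥-elim (fin2-pigeonhole _ _ _ c≢d c≢e d≢e)

  -- Awnings and separations.

  -- The order-free content of an awning.
  record Separation {m} (y : Fin m → Elt G) : Set where
    field
      h     : Fin m → Fin m → Elt G
      C     : Fin m → Elt G → Bool
      h∈    : ∀ {i j} → i ≢ j → InCyc G (h i j) (y i) × InCyc G (h i j) (y j)
      split : ∀ {i j} → i ≢ j → C i (h i j) ≢ C j (h i j)

  separation⇒awning : ∀ {m} {y : Fin m → Elt G} (s : Separation y) →
                      IsAwning G m y (Separation.h s) (Separation.C s)
  separation⇒awning {m} s = record
    { cond1  = λ i j i<j → h∈ (<⇒≢ i<j)
    ; cond2a = λ { i j s r i<j j<s i<r eq refl → flipped eq i<j }
    ; cond2b = λ { i j s r i<j j<s i<r eq refl → flipped eq i<j }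
    ; cond2c = λ { i j s r i<j j<s i<r eq refl → kept eq i<r j<s }
    ; cond2d = λ { i j s r i<j j<s i<r eq refl → kept eq i<r j<s }
    }
    where
    open Separation s
    opposite : ∀ {i j} → i < j → C j (h i j) ≡ not (C i (h i j))
    opposite i<j = 𝔹.¬-not (split (<⇒≢ i<j) ∘ sym)
    flipped : ∀ {i j b} {g : Elt G} → g ≡ h i j → i < j →
              C i (h i j) ≡ b → C j g ≡ not b
    flipped refl i<j refl = opposite i<j
    -- At the common element both `C i` and `C j` are opposite to `C r`, hence equal to each other.
    kept : ∀ {i j r b} → h j r ≡ h i r → i < r → j < r →
           C i (h i r) ≡ b → C j (h j r) ≡ b
    kept {i} {j} {r} eq i<r j<r refl = 𝔹.not-injective
      (trans (sym (opposite j<r)) (trans (cong (C r) eq) (opposite i<r)))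

  module _ {m} {y : Fin m → Elt G} {h : Fin m → Fin m → Elt G}
           {inA : Fin m → Elt G → Bool} (awning : IsAwning G m y h inA) where
    open IsAwning awning

    private
      later? : ∀ j g → Dec (∃ λ s → j < s × h j s ≡ g)
      later? j g = any? λ s → j <? s ×-dec h j s ≟ g

      earlier? : ∀ j g → Dec (∃ λ i → i < j × h i j ≡ g)
      earlier? j g = any? λ i → i <? j ×-dec h i j ≟ g

      -- The awning constrains `inA j` only on H_j. An element outside H_j that is some `h i j` gets
      -- the side opposite to the one it has at i; the final `true` is an arbitrary filler.
      C : Fin m → Elt G → Bool
      C j g with later? j g
      ... | yes _ = inA j g
      ... | no _ with earlier? j g
      ...   | yes (i , _) = not (inA i g)
      ...   | no _        = true

      C-lower : ∀ {i j} → i < j → C i (h i j) ≡ inA i (h i j)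
      C-lower {i} {j} i<j with later? i (h i j)
      ... | yes _ = refl
      ... | no ¬l = contradiction (j , i<j , refl) ¬l

      -- Conditions (2a) and (2b) as one equation; `same-side` does this for (2c) and (2d).
      swap-side : ∀ {i j s} → i < j → j < s → h j s ≡ h i j →
                  inA j (h j s) ≡ not (inA i (h i j))
      swap-side {i} {j} {s} i<j j<s eq with inA i (h i j) in side
      ... | true  = cond2a i j s j i<j j<s i<j eq refl side
      ... | false = cond2b i j s j i<j j<s i<j eq refl side

      same-side : ∀ {i j r} → i < j → j < r → h j r ≡ h i r →
                  inA j (h j r) ≡ inA i (h i r)
      same-side {i} {j} {r} i<j j<r eq with inA i (h i r) in side
      ... | true  = cond2c i j r r i<j j<r (ℕₚ.<-trans i<j j<r) eq refl side
      ... | false = cond2d i j r r i<j j<r (ℕₚ.<-trans i<j j<r) eq refl side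

      C-upper : ∀ {i j} → i < j → C j (h i j) ≡ not (inA i (h i j))
      C-upper {i} {j} i<j with later? j (h i j)
      ... | yes (s , j<s , eq) = trans (cong (inA j) (sym eq)) (swap-side i<j j<s eq)
      ... | no _ with earlier? j (h i j)
      ...   | no ¬e = contradiction (i , i<j , refl) ¬e
      -- The search may return an index other than i for the same element; `same-side` shows that
      -- the two indices agree on its side.
      ...   | yes (i′ , i′<j , eq) with <-cmp i i′
      ...     | tri≈ _ refl _ = refl
      ...     | tri< i<i′ _ _ = cong not
        (trans (cong (inA i′) (sym eq)) (same-side i<i′ i′<j eq))
      ...     | tri> _ _ i′<i = cong not
        (trans (cong (inA i′) (sym eq)) (sym (same-side i′<i i<j (sym eq))))

      split< : ∀ {i j} → i < j → C i (h i j) ≢ C j (h i j)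
      split< i<j eq = 𝔹.not-¬ refl (trans (sym (C-lower i<j)) (trans eq (C-upper i<j)))

      -- Symmetric extension of `h`, which is meaningful only for i < j; the diagonal value is a
      -- filler.
      meet : Fin m → Fin m → Elt G
      meet i j with <-cmp i j
      ... | tri< _ _ _ = h i j
      ... | tri≈ _ _ _ = ε
      ... | tri> _ _ _ = h j i

    awning⇒separation : Separation y
    awning⇒separation = record { h = meet ; C = C ; h∈ = meet∈ ; split = meet-split }
      where
      meet∈ : ∀ {i j} → i ≢ j → InCyc G (meet i j) (y i) × InCyc G (meet i j) (y j)
      meet∈ {i} {j} i≢j with <-cmp i j
      ... | tri< i<j _ _ = cond1 i j i<j
      ... | tri≈ _ i≡j _ = contradiction i≡j i≢j
      ... | tri> _ _ j<i = let p , q = cond1 j i j<i in q , p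
      meet-split : ∀ {i j} → i ≢ j → C i (meet i j) ≢ C j (meet i j)
      meet-split {i} {j} i≢j with <-cmp i j
      ... | tri< i<j _ _ = split< i<j
      ... | tri≈ _ i≡j _ = contradiction i≡j i≢j
      ... | tri> _ _ j<i = split< j<i ∘ sym

  -- A rainbow colouring with two colours.

  module _ {m} {y : Fin m → Elt G} (cover : ∀ a → ∃ λ i → InCyc G a (y i))
           (s : Separation y) where
    open Separation s

    private
      ι-spec : ∀ a → ∃ λ i → InCyc G a (y i) × (∀ j → InCyc G a (y j) → i ≤ j)
      ι-spec a = least (λ i → inCyc? a (y i)) (cover a)

      ι : Elt G → Fin m
      ι a = proj₁ (ι-spec a)

      ι-∈ : ∀ a → InCyc G a (y (ι a))
      ι-∈ a = proj₁ (proj₂ (ι-spec a))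

      ι-min : ∀ {a j} → InCyc G a (y j) → ι a ≤ j
      ι-min {a} = proj₂ (proj₂ (ι-spec a)) _

      -- Renaming the two values of C at a fixed g preserves separation; this
      -- renames them so that the value at ι g becomes zero.
      C′ : Fin m → Elt G → Fin 2
      C′ i g with C i g 𝔹.≟ C (ι g) g
      ... | yes _ = zero
      ... | no _  = suc zero

      C′-ι : ∀ {i g} → i ≡ ι g → C′ i g ≡ zero
      C′-ι {i} {g} i≡ιg with C i g 𝔹.≟ C (ι g) g
      ... | yes _ = refl
      ... | no ≢  = contradiction (cong (λ k → C k g) i≡ιg) ≢

      C′-split : ∀ {i j g} → C i g ≢ C j g → C′ i g ≢ C′ j g
      C′-split {i} {j} {g} i≢j with C i g 𝔹.≟ C (ι g) g | C j g 𝔹.≟ C (ι g) g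
      ... | yes p | yes q = λ _ → i≢j (trans p (sym q))
      ... | yes _ | no _  = λ ()
      ... | no _  | yes _ = λ ()
      ... | no p  | no q  = λ _ → i≢j (trans (𝔹.¬-not p) (sym (𝔹.¬-not q)))

      colour : Elt G → Elt G → Fin 2
      colour a g with inCyc? g (y (ι a)) | inCyc? a (y (ι g))
      ... | yes _ | _     = C′ (ι a) g
      ... | no _  | yes _ = C′ (ι g) a
      ... | no _  | no _  = zero

      mutual-ι : ∀ {a g} → InCyc G g (y (ι a)) → InCyc G a (y (ι g)) → ι a ≡ ι g
      mutual-ι g∈ a∈ = ≤-antisym (ι-min a∈) (ι-min g∈)

      colour-sym : ∀ a g → colour a g ≡ colour g a
      colour-sym a g with inCyc? g (y (ι a)) | inCyc? a (y (ι g))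
      -- The two evaluations use different clauses, `C′ (ι a) g` and `C′ (ι g) a`; since ι a ≡ ι g,
      -- both are zero.
      ... | yes g∈ | yes a∈ = trans (C′-ι (mutual-ι g∈ a∈)) (sym (C′-ι (mutual-ι a∈ g∈)))
      ... | yes _  | no _   = refl
      ... | no _   | yes _  = refl
      ... | no _   | no _   = refl

      colour-ι : ∀ {a g} → InCyc G g (y (ι a)) → colour a g ≡ C′ (ι a) g
      colour-ι {a} {g} g∈ with inCyc? g (y (ι a))
      ... | yes _ = refl
      ... | no g∉ = contradiction g∈ g∉

      ζ : EdgeColouring G 2
      ζ = record { col = colour ; sym = λ a b _ → colour-sym a b }

      ζ-rainbow : IsRainbowColouring G ζ
      ζ-rainbow a b a≢b with ι a ≟ ι b
      ... | yes ιa≡ιb = rainbow₁ ζ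
        (a≢b , y (ι a) , ι-∈ a , subst (λ i → InCyc G b (y i)) (sym ιa≡ιb) (ι-∈ b))
      -- The connecting element may be an endpoint; that endpoint then lies in both subgroups, so a
      -- and b are adjacent.
      ... | no ιa≢ιb with a ≟ h (ι a) (ι b) | b ≟ h (ι a) (ι b) | h∈ ιa≢ιb
      ...   | yes a≡g | _ | _ , g∈b = rainbow₁ ζ
        (a≢b , y (ι b) , subst (λ t → InCyc G t _) (sym a≡g) g∈b , ι-∈ b)
      ...   | no _ | yes b≡g | g∈a , _ = rainbow₁ ζ
        (a≢b , y (ι a) , ι-∈ a , subst (λ t → InCyc G t _) (sym b≡g) g∈a)
      ...   | no a≢g | no b≢g | g∈a , g∈b = rainbow₂ ζ
        (a≢g , y (ι a) , ι-∈ a , g∈a) (b≢g ∘ sym , y (ι b) , g∈b , ι-∈ b) a≢b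
        -- Both edges at the middle vertex g have a colour of the form `C′ k g`, with k = ι a for
        -- one and k = ι b for the other.
        λ eq → C′-split (split ιa≢ιb)
          (trans (sym (colour-ι g∈a))
            (trans eq (trans (colour-sym (h (ι a) (ι b)) b) (colour-ι g∈b))))

    separation⇒rainbow : HasRainbowColouring G 2
    separation⇒rainbow = ζ , ζ-rainbow

  -- A rainbow colouring with three colours.

  module _ (neighbour : ∀ {v} → v ≢ ε → ∃ λ w → w ≢ ε × Adj G v w) where

    private
      -- The graph with ε deleted, kept on the full vertex set by making ε isolated.
      R : Rel (Elt G) 0ℓ
      R v w = v ≢ ε × w ≢ ε × Adj G v w

      partition : ∃ λ (side : Elt G → Bool) →
                  ∀ v → ∃ (R v) → ∃ λ w → R v w × side v ≢ side w
      partition = unfriendlyPartition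
        (λ v w → ¬? (v ≟ ε) ×-dec ¬? (w ≟ ε) ×-dec adj? v w)
        (λ (v≢ε , w≢ε , vw) → w≢ε , v≢ε , adj-sym vw)
        (λ v≡w (_ , _ , v≢w , _) → v≢w v≡w)

      side : Elt G → Bool
      side = proj₁ partition

      spoke : Elt G → Fin 3
      spoke v = if side v then zero else suc zero

      rim : Fin 3
      rim = suc (suc zero)

      spoke≢rim : ∀ v → spoke v ≢ rim
      spoke≢rim v with side v
      ... | true  = λ ()
      ... | false = λ ()

      spoke-split : ∀ {v w} → side v ≢ side w → spoke v ≢ spoke w
      spoke-split {v} {w} v≢w with side v | side w
      ... | true  | true  = λ _ → v≢w refl
      ... | true  | false = λ ()
      ... | false | true  = λ ()
      ... | false | false = λ _ → v≢w refl

      colour : Elt G → Elt G → Fin 3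
      colour a b with a ≟ ε | b ≟ ε
      ... | yes _ | _     = spoke b
      ... | no _  | yes _ = spoke a
      ... | no _  | no _  = rim

      colour-sym : ∀ a b → colour a b ≡ colour b a
      colour-sym a b with a ≟ ε | b ≟ ε
      ... | yes a≡ε | yes b≡ε = cong spoke (trans b≡ε (sym a≡ε))
      ... | yes _   | no _    = refl
      ... | no _    | yes _   = refl
      ... | no _    | no _    = refl

      colour-from-ε : ∀ b → colour ε b ≡ spoke b
      colour-from-ε b with ε ≟ ε | b ≟ ε
      ... | yes _  | _ = refl
      ... | no ε≢ε | _ = contradiction refl ε≢ε

      colour-to-ε : ∀ a → colour a ε ≡ spoke a
      colour-to-ε a = trans (colour-sym a ε) (colour-from-ε a)

      colour-rim : ∀ {a b} → a ≢ ε → b ≢ ε → colour a b ≡ rim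
      colour-rim {a} {b} a≢ε b≢ε with a ≟ ε | b ≟ ε
      ... | yes a≡ε | _       = contradiction a≡ε a≢ε
      ... | no _    | yes b≡ε = contradiction b≡ε b≢ε
      ... | no _    | no _    = refl

      ζ : EdgeColouring G 3
      ζ = record { col = colour ; sym = λ a b _ → colour-sym a b }

      ζ-rainbow : IsRainbowColouring G ζ
      ζ-rainbow a b a≢b with a ≟ ε | b ≟ ε | side a 𝔹.≟ side b
      ... | yes refl | _ | _ = rainbow₁ ζ (adj-sym (adj-ε (a≢b ∘ sym)))
      ... | no a≢ε | yes refl | _ = rainbow₁ ζ (adj-ε a≢ε)
      ... | no a≢ε | no b≢ε | no sa≢sb = rainbow₂ ζ (adj-ε a≢ε) (adj-sym (adj-ε b≢ε)) a≢b
        λ eq → spoke-split sa≢sb (trans (sym (colour-to-ε a)) (trans eq (colour-from-ε b)))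
      -- Detour a - ε - w - b, where w is a neighbour of b on the other side: two spokes of
      -- different colours and one rim edge.
      ... | no a≢ε | no b≢ε | yes sa≡sb
        with proj₂ partition b (let w , w≢ε , bw = neighbour b≢ε in w , b≢ε , w≢ε , bw)
      ...   | w , (_ , w≢ε , bw) , sb≢sw = rainbow₃ ζ
        (adj-ε a≢ε) (adj-sym (adj-ε w≢ε)) (adj-sym bw)
        (λ a≡w → sa≢sw (cong side a≡w)) a≢b (b≢ε ∘ sym)
        (λ eq → spoke-split sa≢sw (trans (sym (colour-to-ε a)) (trans eq (colour-from-ε w))))
        (λ eq → spoke≢rim a (trans (sym (colour-to-ε a)) (trans eq (colour-rim w≢ε b≢ε))))
        (λ eq → spoke≢rim w (trans (sym (colour-from-ε w)) (trans eq (colour-rim w≢ε b≢ε))))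
        where
        sa≢sw : side a ≢ side w
        sa≢sw eq = sb≢sw (trans (sym sa≡sb) eq)

    neighbours⇒rainbow-3 : HasRainbowColouring G 3
    neighbours⇒rainbow-3 = ζ , ζ-rainbow

  -- Generators of the maximal cyclic subgroups.

  module _ {m} {x : Fin m → Elt G} (ess : IsEssentialCyclicSet G m x) where
    open IsEssentialCyclicSet ess

    essential-cover : ∀ a → ∃ λ i → InCyc G a (x i)
    essential-cover a =
      let z , max , a∈z = inMaxCyclic a
          i , z⊆xᵢ , _  = complete z max
      in i , z⊆xᵢ a a∈z

    -- By maximality ⟨x i⟩ and ⟨x j⟩ would both equal ⟨z⟩, against distinctness.
    essential-disjoint : ∀ {i j z} → i ≢ j → InCyc G (x i) z → ¬ InCyc G (x j) z
    essential-disjoint {i} {j} i≢j xᵢ∈z xⱼ∈z = distinct i j i≢j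
      ( inCyc⇒cycSub (inCyc-trans xᵢ∈z (maxCyclic-absorbs (maximal j) xⱼ∈z))
      , inCyc⇒cycSub (inCyc-trans xⱼ∈z (maxCyclic-absorbs (maximal i) xᵢ∈z)))

    essential-injective : ∀ {i j} → i ≢ j → x i ≢ x j
    essential-injective {i} i≢j eq =
      essential-disjoint i≢j inCyc-refl (subst (λ g → InCyc G g (x i)) eq inCyc-refl)

    essential-nonadjacent : ∀ {i j} → i ≢ j → ¬ Adj G (x i) (x j)
    essential-nonadjacent i≢j (_ , _ , xᵢ∈z , xⱼ∈z) = essential-disjoint i≢j xᵢ∈z xⱼ∈z

    rainbow⇒separation : HasRainbowColouring G 2 → Separation x
    rainbow⇒separation rb@(ζ , _) = record
      { h = h ; C = C ; h∈ = h∈ ; split = split }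
      where
      open EdgeColouring ζ using (col)
      via : ∀ {i j} → i ≢ j →
            ∃ λ g → Adj G (x i) g × Adj G g (x j) × col (x i) g ≢ col g (x j)
      via i≢j = nonadjacent⇒via rb (essential-injective i≢j) (essential-nonadjacent i≢j)
      h : Fin m → Fin m → Elt G
      h i j with i ≟ j
      ... | yes _  = ε
      ... | no i≢j = proj₁ (via i≢j)
      C : Fin m → Elt G → Bool
      C i g = does (col (x i) g ≟ zero)
      encode : ∀ {c d : Fin 2} → c ≢ d → does (c ≟ zero) ≢ does (d ≟ zero)
      encode {zero}     {zero}     c≢d _ = c≢d refl
      encode {suc zero} {suc zero} c≢d _ = c≢d refl
      encode {zero}     {suc zero} _ ()
      encode {suc zero} {zero}     _ ()
      h∈ : ∀ {i j} → i ≢ j → InCyc G (h i j) (x i) × InCyc G (h i j) (x j)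
      h∈ {i} {j} i≢j with i ≟ j
      ... | yes i≡j = contradiction i≡j i≢j
      ... | no ≢ = let _ , xᵢg , gxⱼ , _ = via ≢ in
        maxCyclic-adj (maximal i) xᵢg , maxCyclic-adj (maximal j) (adj-sym gxⱼ)
      split : ∀ {i j} → i ≢ j → C i (h i j) ≢ C j (h i j)
      split {i} {j} i≢j with i ≟ j
      ... | yes i≡j = contradiction i≡j i≢j
      ... | no ≢ = let _ , _ , gxⱼ , c≢d = via ≢ in
        -- The path traverses its second edge towards `x j`, while `C j` reads it from `x j`;
        -- symmetry of the colouring reconciles the two.
        encode (λ eq → c≢d (trans eq (sym (EdgeColouring.sym ζ _ _ gxⱼ))))

    rainbow⇔awning : HasRainbowColouring G 2 ⇔ HasAwning G m x
    rainbow⇔awning = mk⇔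
      -- A separation refers to no ordering, so the given enumeration already carries an awning.
      (λ rb → Perm.id , _ , _ , separation⇒awning (rainbow⇒separation rb))
      (λ (σ , _ , _ , awning) → separation⇒rainbow (permuted-cover σ) (awning⇒separation awning))
      where
      permuted-cover : ∀ (σ : Permutation′ m) a → ∃ λ i → InCyc G a (x (σ ⟨$⟩ʳ i))
      permuted-cover σ a = let i , a∈ = essential-cover a in
        σ ⟨$⟩ˡ i , subst (λ k → InCyc G a (x k)) (sym (inverseʳ σ)) a∈

    -- Consequences of vanishing icn.

    module _ (icn≡0 : IcnZero G m x) where

      -- A sole index satisfies `InIcs` vacuously, and an index exists because ε is covered.
      ¬single : ¬ (∀ i j → i ≡ j)
      ¬single all≡ = icn≡0 i λ j j≢i → contradiction (all≡ j i) j≢i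
        where i = proj₁ (essential-cover ε)

      ¬rainbow-0 : ¬ HasRainbowColouring G 0
      -- `col` is total, so it yields a colour even at a pair that is no edge.
      ¬rainbow-0 (ζ , _) with EdgeColouring.col ζ ε ε
      ... | ()

      ¬rainbow-1 : ¬ HasRainbowColouring G 1
      ¬rainbow-1 rb = ¬single single
        where
        single : ∀ i j → i ≡ j
        single i j with i ≟ j
        ... | yes i≡j = i≡j
        ... | no i≢j  = ⊥-elim
          (nonadjacent⇒¬rainbow-1 (essential-injective i≢j) (essential-nonadjacent i≢j) rb)

      ¬cyclic : ¬ IsCyclic G
      ¬cyclic (g , gen) = ¬single single
        where
        single : ∀ i j → i ≡ j
        single i j with i ≟ j
        ... | yes i≡j = i≡j
        ... | no i≢j  = ⊥-elim (essential-disjoint i≢j (gen (x i)) (gen (x j)))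

      -- A vertex v ≢ ε with no neighbour but ε would generate a maximal cyclic
      -- subgroup {ε , v} of order two, which lies in ics(G).
      nontrivial-neighbour : ∀ {v} → v ≢ ε → ∃ λ w → w ≢ ε × Adj G v w
      nontrivial-neighbour {v} v≢ε with any? (λ w → ¬? (w ≟ ε) ×-dec adj? v w)
      ... | yes w = w
      ... | no isolated = ⊥-elim (icn≡0 i independent)
        where
        only-v : ∀ {w z} → w ≢ ε → InCyc G v z → InCyc G w z → v ≡ w
        only-v {w} {z} w≢ε v∈z w∈z with v ≟ w
        ... | yes v≡w = v≡w
        ... | no v≢w  = contradiction (w , w≢ε , v≢w , z , v∈z , w∈z) isolated
        i = proj₁ (essential-cover v)
        generator : ∀ {j} → InCyc G v (x j) → v ≡ x j
        generator {j} v∈ = only-v xⱼ≢ε v∈ inCyc-refl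
          where
          xⱼ≢ε : x j ≢ ε
          xⱼ≢ε eq = let k , eq′ = v∈ in
            v≢ε (trans (sym eq′) (trans (cong (λ g → pow G g k) eq) (pow-ε k)))
        v∈xᵢ : InCyc G v (x i)
        v∈xᵢ = proj₂ (essential-cover v)
        independent : InIcs G m x i
        independent j j≢i y y∈xᵢ y∈xⱼ with y ≟ ε
        ... | yes y≡ε = y≡ε
        -- Such a y is v itself, so v lies in both subgroups and equals both generators.
        ... | no y≢ε  = contradiction (trans (sym (generator v∈xⱼ)) (generator v∈xᵢ))
                                      (essential-injective j≢i)
          where
          v∈xⱼ : InCyc G v (x j)
          v∈xⱼ = subst (λ t → InCyc G t (x j)) (sym (only-v y≢ε v∈xᵢ y∈xᵢ)) y∈xⱼ

theorem3p6 : (G : FiniteGroup) (m : ℕ) (x : Fin m → Elt G) →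
    IsEssentialCyclicSet G m x → IcnZero G m x →
    (RcEq G 1 ⇔ IsCyclic G) ×
    (RcEq G 2 ⇔ (HasAwning G m x × ¬ IsCyclic G)) ×
    (RcEq G 3 ⇔ (¬ HasAwning G m x))
theorem3p6 G m x ess icn≡0 =
    -- Both sides are false: there are two distinct maximal cyclic subgroups, and their generators
    -- are nonadjacent.
    mk⇔ (λ (rb , _) → ⊥-elim (¬rainbow-1 G ess icn≡0 rb))
        (λ cyc → ⊥-elim (¬cyclic G ess icn≡0 cyc))
  , mk⇔ (λ (rb , _) → to rb , ¬cyclic G ess icn≡0)
        (λ (aw , _) → from aw , below₂)
  , mk⇔ (λ (_ , min) aw → min 2 (s≤s (s≤s (s≤s z≤n))) (from aw))
        (λ ¬aw → neighbours⇒rainbow-3 G (nontrivial-neighbour G ess icn≡0) , below₃ ¬aw)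
  where
  open Equivalence (rainbow⇔awning G ess) using (to; from)
  below₂ : ∀ j → j ℕ.< 2 → ¬ HasRainbowColouring G j
  below₂ 0 _ = ¬rainbow-0 G ess icn≡0
  below₂ 1 _ = ¬rainbow-1 G ess icn≡0
  below₂ (suc (suc _)) (s≤s (s≤s ()))
  below₃ : ¬ HasAwning G m x → ∀ j → j ℕ.< 3 → ¬ HasRainbowColouring G j
  below₃ _ 0 _ = ¬rainbow-0 G ess icn≡0
  below₃ _ 1 _ = ¬rainbow-1 G ess icn≡0
  below₃ ¬aw 2 _ = ¬aw ∘ to
  below₃ _ (suc (suc (suc _))) (s≤s (s≤s (s≤s ())))
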